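{- For all integers $k \geq 1$, $$A_{\mathbf{r}}(2^k-1) = \begin{cases} 4 & k=1,\\ 5 & k=2,\\ 9 & k=3,\\ 10 & k=4,\\ 2^{k-1}+3 & k\geq 5 \text{ odd},\\ 2^{k-1}+1 & k\geq 6 \text{ even}.\end{cases}$$
   Context: $\mathbb{N}=\{0,1,2,\dots\}$. For $n\in\mathbb{N}$, $e_{11}(n)$ denotes the number of (possibly overlapping) occurrences of the block $11$ in the binary expansion of $n$, and $r_n = e_{11}(n) \bmod 2$ (Rudin--Shapiro sequence). For $n,d\in\mathbb{N}$, $d\geq1$, let $A_{\mathbf{r}}(n,d)=\inf\{l\geq 1: r_{n+ld}\neq r_n\}$ and $A_{\mathbf{r}}(d)=\sup_{n\in\mathbb{N}} A_{\mathbf{r}}(n,d)$. -}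

module Defs where

open import Data.Nat using (ℕ; zero; suc; _+_; _*_; _∸_; _^_; _≤_; _<_)
open import Data.Nat.DivMod using (_/_; _%_)
open import Data.Product using (Σ; _×_; ∃)
open import Relation.Binary.PropositionalEquality using (_≡_; _≢_)

bit : ℕ → ℕ → ℕ
bit zero    n = n % 2
bit (suc i) n = bit i (n / 2)

pair11 : ℕ → ℕ → ℕ
pair11 i n = bit i n * bit (suc i) n

count11 : ℕ → ℕ → ℕ
count11 zero    n = 0
count11 (suc m) n = count11 m n + pair11 m n

-- e₁₁(n): occurrences of block 11 in binary expansion of n.
-- Since n < 2^(n+1), all nonzero bits are at positions ≤ n, so positions i < n+1 suffice.
e11 : ℕ → ℕ
e11 n = count11 (suc n) n

r : ℕ → ℕ
r n = e11 n % 2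

IsA : ℕ → ℕ → ℕ → Set
IsA n d l = (1 ≤ l) × (r (n + l * d) ≢ r n)
          × (∀ j → 1 ≤ j → j < l → r (n + j * d) ≡ r n)

-- IsSupA d v : v = A_r(d) = sup_n A_r(n,d)  (finite, hence attained):
-- every A_r(n,d) exists and is ≤ v, and some n has A_r(n,d) = v
IsSupA : ℕ → ℕ → Set
IsSupA d v = (∀ n → Σ ℕ (λ l → IsA n d l × l ≤ v)) × ∃ (λ n → IsA n d v)

value : ℕ → ℕ
value 0 = 0
value 1 = 4
value 2 = 5
value 3 = 9
value 4 = 10
value (suc k) = 2 ^ k + (1 + 2 * (suc k % 2))

{-# OPTIONS --safe #-}

-- Write k = h + 1, H = 2 ^ h and D = 2 ^ k - 1 = 2 H - 1. Along n, n + D, n + 2 D, …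
-- the residue modulo H drops by 1 at each step and the quotient grows by 2, until the
-- residue passes from 0 to H - 1. On the last few terms before such a crossing and the
-- first few after it, r depends, by the complement symmetry of the digits below 2 ^ h,
-- only on the parity of h and on r near the quotient, hence on finitely many bits; a
-- finite check bounds how long r can stay constant around the crossing. Since crossings
-- are exactly H steps apart, this gives the upper bounds for k ≥ 5. By the same symmetry,
-- r is constant on the H + 1 terms from 4 ^ k + 2 ^ k - 1 and changes at the next one; for
-- odd k the two preceding terms of the progression can be added.
module Submission where

open import Defs
open import Data.Bool using (Bool; true; false; not; _∧_; _xor_; if_then_else_; T)
open import Data.Bool.Properties using (not-¬)
open import Data.Bool.Solver using (module xor-∧-Solver)
open import Data.Nat
open import Data.Nat.DivMod
open import Data.Nat.Properties
open import Data.Nat.Tactic.RingSolver using (solve-∀)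
open import Data.Product using (Σ; ∃; _×_; _,_; proj₁; proj₂)
open import Data.Sum using (_⊎_; inj₁; inj₂)
open import Data.Unit using (tt)
open import Function using (_∘_)
open import Relation.Nullary using (yes; no; contradiction)
open import Relation.Binary.PropositionalEquality

-- Binary digits and parity.

⟦_⟧ : Bool → ℕ
⟦ false ⟧ = 0
⟦ true  ⟧ = 1

-- Boolean-valued, so that parities of counts add by `xor`, identities between them go to the xor-∧
-- solver, and finite checks evaluate.
odd : ℕ → Bool
odd n = n % 2 ≡ᵇ 1

%2≡⟦odd⟧ : ∀ n → n % 2 ≡ ⟦ odd n ⟧
%2≡⟦odd⟧ n with n % 2 | m%n<n n 2
... | 0 | _ = refl
... | 1 | _ = refl
... | suc (suc _) | s≤s (s≤s ())

odd-half : ∀ n → ⟦ odd n ⟧ + 2 * (n / 2) ≡ n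
odd-half n = sym (trans (m≡m%n+[m/n]*n n 2) (cong₂ _+_ (%2≡⟦odd⟧ n) (*-comm (n / 2) 2)))

odd-cons : ∀ b n → odd (⟦ b ⟧ + 2 * n) ≡ b
odd-cons b n = trans (cong (_≡ᵇ 1) (trans (cong (λ x → (⟦ b ⟧ + x) % 2) (*-comm 2 n)) ([m+kn]%n≡m%n ⟦ b ⟧ n 2))) (lem b)
  where
  lem : ∀ b → odd ⟦ b ⟧ ≡ b
  lem false = refl
  lem true  = refl

half-cons : ∀ b n → (⟦ b ⟧ + 2 * n) / 2 ≡ n
half-cons b n = *-cancelˡ-≡ _ n 2 (+-cancelˡ-≡ ⟦ b ⟧ _ _
  (trans (cong (λ c → ⟦ c ⟧ + 2 * ((⟦ b ⟧ + 2 * n) / 2)) (sym (odd-cons b n))) (odd-half (⟦ b ⟧ + 2 * n))))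

odd-suc : ∀ n → odd (suc n) ≡ not (odd n)
odd-suc n = trans (cong (λ x → odd (suc x)) (sym (odd-half n))) (lem (odd n))
  where
  lem : ∀ b → odd (suc (⟦ b ⟧ + 2 * (n / 2))) ≡ not b
  lem false = odd-cons true (n / 2)
  lem true  = trans (cong odd (sym (*-suc 2 (n / 2)))) (odd-cons false (suc (n / 2)))

odd-+ : ∀ m n → odd (m + n) ≡ odd m xor odd n
odd-+ zero    n = refl
odd-+ (suc m) n = trans (odd-suc (m + n)) (trans (cong not (odd-+ m n))
  (trans (lem (odd m) (odd n)) (cong (_xor odd n) (sym (odd-suc m)))))
  where
  lem : ∀ a b → not (a xor b) ≡ not a xor b
  lem false b     = refl
  lem true  false = refl
  lem true  true  = refl

odd-2* : ∀ n → odd (2 * n) ≡ false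
odd-2* = odd-cons false

odd-2^ : ∀ K n → odd (2 ^ suc K * n) ≡ false
odd-2^ K n = trans (cong odd (*-assoc 2 (2 ^ K) n)) (odd-2* (2 ^ K * n))

-- The Rudin-Shapiro sequence as a recursion on binary digits.

R : ℕ → Bool
R n = odd (e11 n)

R≡⇒r≡ : ∀ {m n} → R m ≡ R n → r m ≡ r n
R≡⇒r≡ {m} {n} eq = trans (%2≡⟦odd⟧ (e11 m)) (trans (cong ⟦_⟧ eq) (sym (%2≡⟦odd⟧ (e11 n))))

r≡⇒R≡ : ∀ {m n} → r m ≡ r n → R m ≡ R n
r≡⇒R≡ = cong (_≡ᵇ 1)

bit-vanish : ∀ i n → n ≤ i → bit i n ≡ 0
bit-vanish zero    .zero z≤n = refl
bit-vanish (suc i) n n≤1+i   = bit-vanish i (n / 2) (halve n n≤1+i)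
  where
  halve : ∀ n → n ≤ suc i → n / 2 ≤ i
  halve zero    _   = z≤n
  halve (suc n) n≤i = ≤-pred (≤-trans (m/n<m (suc n) 2 (s≤s (s≤s z≤n))) n≤i)

count11-stable : ∀ d n → count11 (d + n) n ≡ count11 n n
count11-stable zero    n = refl
count11-stable (suc d) n =
  trans (cong (λ b → count11 (d + n) n + b * bit (suc (d + n)) n) (bit-vanish (d + n) n (m≤n+m n d)))
        (trans (+-identityʳ _) (count11-stable d n))

count11-step : ∀ m n → count11 (suc m) n ≡ pair11 0 n + count11 m (n / 2)
count11-step zero    n = sym (+-identityʳ _)
count11-step (suc m) n = trans (cong (_+ pair11 (suc m) n) (count11-step m n)) (+-assoc (pair11 0 n) _ _)

-- Removing position 0 leaves n positions to be counted in `n / 2`, while `e11 (n / 2)` looks at its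
-- own number of positions. Both counts agree, since digits from position `n / 2` on vanish.
e11-step : ∀ n → e11 n ≡ pair11 0 n + e11 (n / 2)
e11-step n = trans (count11-step n n) (cong (pair11 0 n +_) (begin
  count11 n (n / 2)                    ≡⟨ cong (λ m → count11 m (n / 2)) (sym (m∸n+n≡m (m/n≤m n 2))) ⟩
  count11 (n ∸ n / 2 + n / 2) (n / 2)  ≡⟨ count11-stable (n ∸ n / 2) (n / 2) ⟩
  count11 (n / 2) (n / 2)              ≡⟨ sym (count11-stable 1 (n / 2)) ⟩
  e11 (n / 2)                          ∎))
  where open ≡-Reasoning

R-step : ∀ n → R n ≡ (odd n ∧ odd (n / 2)) xor R (n / 2)
R-step n = trans (cong odd (e11-step n)) (trans (odd-+ (pair11 0 n) (e11 (n / 2))) (cong (_xor R (n / 2))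
  (trans (cong₂ (λ a b → odd (a * b)) (%2≡⟦odd⟧ n) (%2≡⟦odd⟧ (n / 2))) (lem (odd n) (odd (n / 2))))))
  where
  lem : ∀ a b → odd (⟦ a ⟧ * ⟦ b ⟧) ≡ a ∧ b
  lem false b     = refl
  lem true  false = refl
  lem true  true  = refl

R-cons : ∀ b n → R (⟦ b ⟧ + 2 * n) ≡ (b ∧ odd n) xor R n
R-cons b n rewrite R-step (⟦ b ⟧ + 2 * n) | odd-cons b n | half-cons b n = refl

R-2* : ∀ n → R (2 * n) ≡ R n
R-2* = R-cons false

R-2^ : ∀ K n → R (2 ^ K * n) ≡ R n
R-2^ zero    n = cong R (+-identityʳ n)
R-2^ (suc K) n = trans (cong R (*-assoc 2 (2 ^ K) n)) (trans (R-2* (2 ^ K * n)) (R-2^ K n))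

-- Words of low digits and their complements.

-- The low K binary digits of s, topped by the digit o: `lowest` is the last
-- digit of this word and `pairs` the parity of its number of blocks 11.
lowest : ℕ → Bool → ℕ → Bool
lowest zero    o s = o
lowest (suc K) o s = odd s

pairs : ℕ → Bool → ℕ → Bool
pairs zero    o s = false
pairs (suc K) o s = (odd s ∧ lowest K o (s / 2)) xor pairs K o (s / 2)

half-< : ∀ K {s} → s < 2 ^ suc K → s / 2 < 2 ^ K
half-< K {s} s< = m<n*o⇒m/o<n (subst (s <_) (*-comm 2 (2 ^ K)) s<)

cons-2^ : ∀ K m s → 2 ^ suc K * m + s ≡ ⟦ odd s ⟧ + 2 * (2 ^ K * m + s / 2)
cons-2^ K m s = trans (cong (2 ^ suc K * m +_) (sym (odd-half s))) (lem (2 ^ K) m ⟦ odd s ⟧ (s / 2))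
  where
  lem : ∀ p m b h → (2 * p) * m + (b + 2 * h) ≡ b + 2 * (p * m + h)
  lem = solve-∀

odd-block : ∀ K m {s} → s < 2 ^ K → odd (2 ^ K * m + s) ≡ lowest K (odd m) s
odd-block zero    m {zero}  _ = cong odd (trans (+-identityʳ _) (*-identityˡ m))
odd-block zero    m {suc s} (s≤s ())
odd-block (suc K) m {s} s< = trans (cong odd (cons-2^ K m s)) (odd-cons (odd s) (2 ^ K * m + s / 2))

-- The two digit words interact only where they meet, and `pairs` accounts for that block through
-- the last digit of m.
R-block : ∀ K m {s} → s < 2 ^ K → R (2 ^ K * m + s) ≡ pairs K (odd m) s xor R m
R-block zero    m {zero}  _ = cong R (trans (+-identityʳ _) (*-identityˡ m))
R-block zero    m {suc s} (s≤s ())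
R-block (suc K) m {s} s< rewrite cons-2^ K m s | R-cons (odd s) (2 ^ K * m + s / 2)
  | odd-block K m (half-< K s<) | R-block K m (half-< K s<)
  = lem (odd s ∧ lowest K (odd m) (s / 2)) (pairs K (odd m) (s / 2)) (R m)
  where
  lem : ∀ a b c → a xor (b xor c) ≡ (a xor b) xor c
  lem = solve 3 (λ a b c → a :+ (b :+ c) := (a :+ b) :+ c) refl
    where open xor-∧-Solver

pairs-zero : ∀ K o → pairs K o 0 ≡ false
pairs-zero zero    o = refl
pairs-zero (suc K) o = pairs-zero K o

-- At least one leading zero, provided by `suc L`, separates the digits of s from o.
pairs-small : ∀ K L o {s} → s < 2 ^ K → pairs (K + suc L) o s ≡ pairs K false s
pairs-small zero    L o {zero}  _ = pairs-zero L o
pairs-small zero    L o {suc s} (s≤s ())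
pairs-small (suc K) L o {s} s< = cong₂ (λ a b → (odd s ∧ a) xor b) (lem K (half-< K s<)) (pairs-small K L o (half-< K s<))
  where
  lem : ∀ K {s} → s < 2 ^ K → lowest (K + suc L) o s ≡ lowest K false s
  lem zero    {zero}  _ = refl
  lem zero    {suc s} (s≤s ())
  lem (suc K) _ = refl

-- The number with digits o, b followed by s is split by `R-block` in two ways, below o and below b;
-- single digits contain no block 11.
pairs-top : ∀ K o b {s} → s < 2 ^ K → pairs (suc K) o (2 ^ K * ⟦ b ⟧ + s) ≡ pairs K b s xor (b ∧ o)
pairs-top K o b {s} s< = begin
  pairs (suc K) o t              ≡⟨ xor-false _ ⟨
  pairs (suc K) o t xor false    ≡⟨ cong₂ (λ x y → pairs (suc K) x t xor y) (odd⟦⟧ o) (R⟦⟧ o) ⟨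
  pairs (suc K) (odd ⟦ o ⟧) t xor R ⟦ o ⟧ ≡⟨ R-block (suc K) ⟦ o ⟧ t< ⟨
  R (2 ^ suc K * ⟦ o ⟧ + t)      ≡⟨ cong R (lem (2 ^ K) ⟦ o ⟧ ⟦ b ⟧ s) ⟩
  R (2 ^ K * (⟦ b ⟧ + 2 * ⟦ o ⟧) + s) ≡⟨ R-block K (⟦ b ⟧ + 2 * ⟦ o ⟧) s< ⟩
  pairs K (odd (⟦ b ⟧ + 2 * ⟦ o ⟧)) s xor R (⟦ b ⟧ + 2 * ⟦ o ⟧)
    ≡⟨ cong₂ (λ x y → pairs K x s xor y) (odd-cons b ⟦ o ⟧) (trans (R-cons b ⟦ o ⟧) (cong₂ (λ x y → (b ∧ x) xor y) (odd⟦⟧ o) (R⟦⟧ o))) ⟩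
  pairs K b s xor ((b ∧ o) xor false) ≡⟨ cong (pairs K b s xor_) (xor-false _) ⟩
  pairs K b s xor (b ∧ o)        ∎
  where
  open ≡-Reasoning
  t = 2 ^ K * ⟦ b ⟧ + s
  xor-false : ∀ a → a xor false ≡ a
  xor-false false = refl
  xor-false true  = refl
  odd⟦⟧ : ∀ b → odd ⟦ b ⟧ ≡ b
  odd⟦⟧ false = refl
  odd⟦⟧ true  = refl
  R⟦⟧ : ∀ b → R ⟦ b ⟧ ≡ false
  R⟦⟧ false = refl
  R⟦⟧ true  = refl
  ⟦⟧≤1 : ∀ b → ⟦ b ⟧ ≤ 1
  ⟦⟧≤1 false = z≤n
  ⟦⟧≤1 true  = ≤-refl
  t< : t < 2 ^ suc K
  t< = subst (t <_) (cong (_+ (2 ^ K + 0)) (*-identityʳ (2 ^ K)))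
         (+-mono-≤-< (*-monoʳ-≤ (2 ^ K) (⟦⟧≤1 b)) (subst (s <_) (sym (+-identityʳ _)) s<))
  lem : ∀ p o b s → (2 * p) * o + (p * b + s) ≡ p * (b + 2 * o) + s
  lem = solve-∀

-- Two numbers with the odd sum 2n - 1 have different last digits, and these add up to 1 without a
-- carry. This is the induction step for complementary words.
odd-complement : ∀ a b {s c n} → suc ((⟦ a ⟧ + 2 * s) + (⟦ b ⟧ + 2 * c)) ≡ 2 * n → a ≡ not b × suc (s + c) ≡ n
odd-complement a b {s} {c} {n} eq = a≡ , *-cancelˡ-≡ _ _ 2 (trans (lem₂ a b a≡) eq)
  where
  par : odd (suc ((⟦ a ⟧ + 2 * s) + (⟦ b ⟧ + 2 * c))) ≡ not (a xor b)
  par = trans (odd-suc ((⟦ a ⟧ + 2 * s) + (⟦ b ⟧ + 2 * c)))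
    (cong not (trans (odd-+ (⟦ a ⟧ + 2 * s) (⟦ b ⟧ + 2 * c)) (cong₂ _xor_ (odd-cons a s) (odd-cons b c))))
  lem₁ : ∀ a b → not (a xor b) ≡ false → a ≡ not b
  lem₁ false true  _ = refl
  lem₁ true  false _ = refl
  lem₁ false false ()
  lem₁ true  true  ()
  ring₁ : ∀ s c → 2 * (1 + (s + c)) ≡ 1 + ((0 + 2 * s) + (1 + 2 * c))
  ring₁ = solve-∀
  ring₂ : ∀ s c → 2 * (1 + (s + c)) ≡ 1 + ((1 + 2 * s) + (0 + 2 * c))
  ring₂ = solve-∀
  a≡ : a ≡ not b
  a≡ = lem₁ a b (trans (sym par) (trans (cong odd eq) (odd-2* n)))
  lem₂ : ∀ a b → a ≡ not b → 2 * suc (s + c) ≡ suc ((⟦ a ⟧ + 2 * s) + (⟦ b ⟧ + 2 * c))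
  lem₂ false true  _ = ring₁ s c
  lem₂ true  false _ = ring₂ s c

-- The words (o , c) and (not o , i) are complementary, so the blocks 11 of the latter
-- are the blocks 00 of the former. Hence the two counts add up to K minus the number
-- of digit changes, which has the parity of (first digit) + (last digit).
pairs-complement : ∀ K o {c i} → suc (c + i) ≡ 2 ^ K →
  lowest K o c ≡ not (lowest K (not o) i) ×
  pairs K o c ≡ pairs K (not o) i xor (odd K xor (o xor lowest K o c))
pairs-complement zero false eq = refl , refl
pairs-complement zero true  eq = refl , refl
pairs-complement (suc K) o {c} {i} eq
  with odd-complement (odd c) (odd i) {c / 2} {i / 2} {2 ^ K} (trans (cong₂ (λ x y → suc (x + y)) (odd-half c) (odd-half i)) eq)
... | c≡ , eq′ with pairs-complement K o {c / 2} {i / 2} eq′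
... | l≡ , p≡ rewrite odd-suc K | p≡ | l≡ | c≡ = refl ,
  lem (odd i) (lowest K (not o) (i / 2)) (pairs K (not o) (i / 2)) (odd K) o
  where
  lem : ∀ a b p k o → (not a ∧ not b) xor (p xor (k xor (o xor not b)))
                    ≡ ((a ∧ b) xor p) xor (not k xor (o xor not a))
  lem = solve 5 (λ a b p k o →
          ((con true :+ a) :* (con true :+ b)) :+ (p :+ (k :+ (o :+ (con true :+ b)))) :=
          ((a :* b) :+ p) :+ ((con true :+ k) :+ (o :+ (con true :+ a)))) refl
    where open xor-∧-Solver

-- Constancy on an initial segment.

const : ℕ → (ℕ → Bool) → Bool
const zero    f = true
const (suc L) f = not (f (suc L) xor f 0) ∧ const L f

const-cong : ∀ L {f g} → (∀ j → j ≤ L → f j ≡ g j) → const L f ≡ const L g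
const-cong zero    eq = refl
const-cong (suc L) eq = cong₂ _∧_ (cong not (cong₂ _xor_ (eq (suc L) ≤-refl) (eq 0 z≤n)))
                                  (const-cong L (λ j j≤L → eq j (m≤n⇒m≤1+n j≤L)))

const-elim : ∀ L f → const L f ≡ true → ∀ j → j ≤ L → f j ≡ f 0
const-elim zero    f c .zero z≤n = refl
const-elim (suc L) f c j j≤ with f (suc L) in p | f 0 in q | m≤n⇒m<n∨m≡n j≤
... | true  | true  | inj₂ refl = p
... | false | false | inj₂ refl = p
... | true  | true  | inj₁ j<   = trans (const-elim L f c j (≤-pred j<)) q
... | false | false | inj₁ j<   = trans (const-elim L f c j (≤-pred j<)) q

const-intro : ∀ L f → (∀ j → j ≤ L → f j ≡ f 0) → const L f ≡ true
const-intro zero    f eq = refl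
const-intro (suc L) f eq rewrite eq (suc L) ≤-refl | const-intro L f (λ j j≤L → eq j (m≤n⇒m≤1+n j≤L)) = lem (f 0)
  where
  lem : ∀ a → not (a xor a) ∧ true ≡ true
  lem false = refl
  lem true  = refl

const-shift : ∀ {L l} j f → j + l ≤ L → const l (λ i → f (j + i)) ≡ false → const L f ≡ false
const-shift {L} {l} j f j+l≤L nc with const L f in c
... | false = refl
... | true  = contradiction (trans (sym nc) (const-intro l _ λ i i≤l →
  trans (at (j + i) (≤-trans (+-monoʳ-≤ j i≤l) j+l≤L))
        (sym (at (j + 0) (≤-trans (+-monoʳ-≤ j z≤n) j+l≤L))))) λ ()
  where
  at : ∀ i → i ≤ L → f i ≡ f 0
  at = const-elim L f c

first-change : ∀ L f → const L f ≡ false →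
  Σ ℕ λ l → (1 ≤ l × f l ≢ f 0 × (∀ j → 1 ≤ j → j < l → f j ≡ f 0)) × l ≤ L
first-change (suc L) f c with const L f in eq
... | false with first-change L f eq
...   | l , isFirst , l≤L = l , isFirst , m≤n⇒m≤1+n l≤L
first-change (suc L) f c | true = suc L ,
  (s≤s z≤n , (λ e → ne (f (suc L)) (f 0) c e) , λ j _ j<l → const-elim L f eq j (≤-pred j<l)) , ≤-refl
  where
  ne : ∀ a b → not (a xor b) ∧ true ≡ false → a ≢ b
  ne false .false () refl
  ne true  .true  () refl

-- Refutation by finite checks.

allBool : (Bool → Bool) → Bool
allBool φ = φ false ∧ φ true

allBelow : ℕ → (ℕ → Bool) → Bool
allBelow zero    φ = true
allBelow (suc N) φ = φ N ∧ allBelow N φ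

∧-true : ∀ {a b} → a ∧ b ≡ true → a ≡ true × b ≡ true
∧-true {true} {true} _ = refl , refl

allBool-elim : ∀ φ → allBool φ ≡ true → ∀ b → φ b ≡ true
allBool-elim φ all false = proj₁ (∧-true all)
allBool-elim φ all true  = proj₂ (∧-true all)

allBelow-elim : ∀ N φ → allBelow N φ ≡ true → ∀ {n} → n < N → φ n ≡ true
allBelow-elim (suc N) φ all {n} n<1+N with m≤n⇒m<n∨m≡n (≤-pred n<1+N)
... | inj₁ n<N  = allBelow-elim N φ (proj₂ (∧-true all)) n<N
... | inj₂ refl = proj₁ (∧-true all)

-- The value of R at 2 ^ K * m + s, for s < 2 * 2 ^ K, as a function of
-- u = R m, v = R (m + 1) and p = odd m.
window : ℕ → Bool → Bool → Bool → ℕ → Bool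
window K u v p s = if s <ᵇ 2 ^ K then pairs K p s xor u else pairs K (not p) (s ∸ 2 ^ K) xor v

window-correct : ∀ K m {s} → s < 2 ^ suc K → window K (R m) (R (suc m)) (odd m) s ≡ R (2 ^ K * m + s)
window-correct K m {s} s< with s <ᵇ 2 ^ K in eq
... | true  = sym (R-block K m (<ᵇ⇒< s (2 ^ K) (subst T (sym eq) tt)))
... | false = begin
  pairs K (not (odd m)) (s ∸ 2 ^ K) xor R (suc m)  ≡⟨ cong (λ o → pairs K o (s ∸ 2 ^ K) xor R (suc m)) (odd-suc m) ⟨
  pairs K (odd (suc m)) (s ∸ 2 ^ K) xor R (suc m)  ≡⟨ R-block K (suc m) low ⟨
  R (2 ^ K * suc m + (s ∸ 2 ^ K))                  ≡⟨ cong (λ x → R (x + (s ∸ 2 ^ K))) (trans (*-suc (2 ^ K) m) (+-comm (2 ^ K) _)) ⟩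
  R (2 ^ K * m + 2 ^ K + (s ∸ 2 ^ K))              ≡⟨ cong R (trans (+-assoc (2 ^ K * m) _ _) (cong (2 ^ K * m +_) (m+[n∸m]≡n ge))) ⟩
  R (2 ^ K * m + s)                                ∎
  where
  open ≡-Reasoning
  ge : 2 ^ K ≤ s
  ge = ≮⇒≥ λ lt → subst T eq (<⇒<ᵇ lt)
  low : s ∸ 2 ^ K < 2 ^ K
  low = +-cancelˡ-< (2 ^ K) _ _ (subst₂ _<_ (sym (m+[n∸m]≡n ge)) (cong (2 ^ K +_) (+-identityʳ _)) s<)

2^-split : ∀ h n → ∃ λ z → ∃ λ p → p < 2 ^ h × n ≡ 2 ^ h * z + p
2^-split h n = n / 2 ^ h , n % 2 ^ h , m%n<n n (2 ^ h) ,
  trans (m≡m%n+[m/n]*n n (2 ^ h)) (trans (+-comm _ (n / 2 ^ h * 2 ^ h)) (cong (_+ n % 2 ^ h) (*-comm _ (2 ^ h))))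
  where
  instance
    _ : NonZero (2 ^ h)
    _ = m^n≢0 2 h

-- The first argument of φ is to be the parity of n, but only the offset `t` of n in its block is
-- available. The two parities agree for blocks of even length, as in `refute`.
neverHolds : ℕ → (Bool → (ℕ → Bool) → Bool) → Bool
neverHolds K φ = allBool λ u → allBool λ v → allBool λ p → allBelow (2 ^ K) λ t →
  not (φ (odd t) λ s → window K u v p (t + s))

-- A property of the parity of n and of R n , … , R (n + B), where B ≤ 2 ^ (K + 1), is
-- refuted for all n by a finite check, as n , … , n + B meets at most two
-- blocks of length 2 ^ (K + 1).
refute : ∀ K B → B ≤ 2 ^ suc K → (φ : Bool → (ℕ → Bool) → Bool) →
  (∀ o {ω ω′} → (∀ s → s ≤ B → ω s ≡ ω′ s) → φ o ω ≡ φ o ω′) →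
  neverHolds (suc K) φ ≡ true → ∀ n → φ (odd n) (λ s → R (n + s)) ≡ false
refute K B B≤ φ φ-cong check n with 2^-split (suc K) n
... | m , t , t< , refl = begin
  φ (odd n) (λ s → R (n + s))                          ≡⟨ φ-cong (odd n) windowed ⟩
  φ (odd n) (window (suc K) (R m) (R (suc m)) (odd m) ∘ (t +_)) ≡⟨ cong (λ o → φ o (window (suc K) (R m) (R (suc m)) (odd m) ∘ (t +_))) odd-n ⟩
  φ (odd t) (window (suc K) (R m) (R (suc m)) (odd m) ∘ (t +_)) ≡⟨ not-true refuted-here ⟩
  false                                                ∎
  where
  open ≡-Reasoning
  windowed : ∀ s → s ≤ B → R (n + s) ≡ window (suc K) (R m) (R (suc m)) (odd m) (t + s)
  windowed s s≤B = trans (cong R (+-assoc (2 ^ suc K * m) t s)) (sym (window-correct (suc K) m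
    (subst (t + s <_) (cong (2 ^ suc K +_) (sym (+-identityʳ _))) (+-mono-<-≤ t< (≤-trans s≤B B≤)))))
  odd-n : odd n ≡ odd t
  odd-n = trans (odd-+ (2 ^ suc K * m) t) (cong (_xor odd t) (odd-2^ K m))
  refuted : Bool → Bool → Bool → ℕ → Bool
  refuted u v p t = not (φ (odd t) λ s → window (suc K) u v p (t + s))
  refuted-here : refuted (R m) (R (suc m)) (odd m) t ≡ true
  refuted-here = allBelow-elim (2 ^ suc K) (refuted (R m) (R (suc m)) (odd m))
    (allBool-elim (λ p → allBelow (2 ^ suc K) (refuted (R m) (R (suc m)) p))
      (allBool-elim (λ v → allBool λ p → allBelow (2 ^ suc K) (refuted (R m) v p))
        (allBool-elim (λ u → allBool λ v → allBool λ p → allBelow (2 ^ suc K) (refuted u v p)) check (R m))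
        (R (suc m)))
      (odd m)) t<
  not-true : ∀ {a} → not a ≡ true → a ≡ false
  not-true {false} _ = refl

-- Progressions of difference 2H - 1 around a crossing.

descend : ∀ H {D} z j i → suc D ≡ 2 * H → H * z + (j + i) + j * D ≡ H * (z + 2 * j) + i
descend H {D} z j i D≡ = trans (ring₁ H z i j D) (trans (cong (λ y → H * z + j * y + i) D≡) (ring₂ H z i j))
  where
  ring₁ : ∀ p z i j D → p * z + (j + i) + j * D ≡ p * z + j * (1 + D) + i
  ring₁ = solve-∀
  ring₂ : ∀ p z i j → p * z + j * (2 * p) + i ≡ p * (z + 2 * j) + i
  ring₂ = solve-∀

-- R along the progression e + j (2H - 1) with e = H z + i₀ and H = 2 ^ h, where
-- c = odd h, o = odd z and ω s = R (z + s):
-- while j ≤ i₀ the residue modulo H decreases to 0, then it restarts from H - 1.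
crossing : Bool → ℕ → ℕ → Bool → (ℕ → Bool) → ℕ → Bool
crossing c K i₀ o ω j =
  if j ≤ᵇ i₀ then pairs K false (i₀ ∸ j) xor ω (2 * j)
  else (pairs K false (j ∸ suc i₀) xor (c xor (not o xor not (odd (j ∸ suc i₀))))) xor ω (2 * j ∸ 1)

crossing-cong : ∀ c K i₀ o {ω ω′} j → (∀ s → s ≤ 2 * j → ω s ≡ ω′ s) → crossing c K i₀ o ω j ≡ crossing c K i₀ o ω′ j
crossing-cong c K i₀ o j eq with j ≤ᵇ i₀
... | true  = cong (pairs K false (i₀ ∸ j) xor_) (eq (2 * j) ≤-refl)
... | false rewrite eq (2 * j ∸ 1) (m∸n≤m (2 * j) 1) = refl

-- Before the crossing the residue is below 2 ^ K, so a leading zero hides the parity of the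
-- quotient. After it the residue is the h-digit complement of i = j - i₀ - 1, and
-- `pairs-complement` trades it for i, to which the same remark applies.
crossing-correct : ∀ K x i₀ z D j → suc D ≡ 2 * 2 ^ (K + suc x) → i₀ < 2 ^ K → j ∸ suc i₀ < 2 ^ K →
  R (2 ^ (K + suc x) * z + i₀ + j * D) ≡ crossing (odd (K + suc x)) K i₀ (odd z) (λ s → R (z + s)) j
crossing-correct K x i₀ z D j D≡ i₀< i< with j ≤ᵇ i₀ in eq
... | true  = begin
  R (H * z + i₀ + j * D)                       ≡⟨ cong R (trans (cong (λ y → H * z + y + j * D) (sym j+i≡i₀)) (descend H z j (i₀ ∸ j) D≡)) ⟩
  R (H * (z + 2 * j) + (i₀ ∸ j))               ≡⟨ R-block (K + suc x) (z + 2 * j) (<-≤-trans low (^-monoʳ-≤ 2 (m≤m+n K (suc x)))) ⟩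
  pairs (K + suc x) (odd (z + 2 * j)) (i₀ ∸ j) xor R (z + 2 * j)
    ≡⟨ cong (_xor R (z + 2 * j)) (pairs-small K x (odd (z + 2 * j)) low) ⟩
  pairs K false (i₀ ∸ j) xor R (z + 2 * j)     ∎
  where
  open ≡-Reasoning
  H = 2 ^ (K + suc x)
  j+i≡i₀ : j + (i₀ ∸ j) ≡ i₀
  j+i≡i₀ = m+[n∸m]≡n (≤ᵇ⇒≤ j i₀ (subst T (sym eq) tt))
  low : i₀ ∸ j < 2 ^ K
  low = ≤-<-trans (m∸n≤m i₀ j) i₀<
... | false = begin
  R (H * z + i₀ + j * D)                       ≡⟨ cong R (arith i j≡) ⟩
  R (H * z′ + c)                               ≡⟨ R-block h z′ c< ⟩
  pairs h (odd z′) c xor R z′                  ≡⟨ cong (_xor R z′) (proj₂ (pairs-complement h (odd z′) ci)) ⟩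
  (pairs h (not (odd z′)) i xor (odd h xor (odd z′ xor lowest h (odd z′) c))) xor R z′
    ≡⟨ cong₂ (λ a b → (a xor (odd h xor b)) xor R z′) (pairs-small K x (not (odd z′)) i<)
         (cong₂ _xor_ odd-z′ (trans (proj₁ (pairs-complement h (odd z′) ci)) (cong not (lowest-pos K)))) ⟩
  (pairs K false i xor (odd h xor (not (odd z) xor not (odd i)))) xor R z′ ∎
  where
  open ≡-Reasoning
  h = K + suc x
  H = 2 ^ h
  i = j ∸ suc i₀
  z′ = z + (2 * j ∸ 1)
  c = H ∸ suc i
  i<H : i < H
  i<H = <-≤-trans i< (^-monoʳ-≤ 2 (m≤m+n K (suc x)))
  ci : suc (c + i) ≡ H
  ci = trans (sym (+-suc c i)) (m∸n+n≡m i<H)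
  c< : c < H
  c< = subst (suc c ≤_) ci (s≤s (m≤m+n c i))
  j> : i₀ < j
  j> = ≰⇒> λ le → subst T eq (≤⇒≤ᵇ le)
  j≡ : suc i₀ + i ≡ j
  j≡ = m+[n∸m]≡n j>
  lowest-pos : ∀ K {o} → lowest (K + suc x) o i ≡ odd i
  lowest-pos zero    = refl
  lowest-pos (suc K) = refl
  2j≡ : suc (2 * j ∸ 1) ≡ 2 * j
  2j≡ = m+[n∸m]≡n {1} (≤-trans (s≤s z≤n) (≤-trans j> (m≤m+n j (j + 0))))
  odd-z′ : odd z′ ≡ not (odd z)
  odd-z′ = trans (odd-+ z (2 * j ∸ 1)) (trans (cong (odd z xor_) (trans (sym (not-not _)) (cong not
      (trans (sym (odd-suc (2 * j ∸ 1))) (trans (cong odd 2j≡) (odd-2* j)))))) (xor-true (odd z)))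
    where
    not-not : ∀ a → not (not a) ≡ a
    not-not false = refl
    not-not true  = refl
    xor-true : ∀ a → a xor true ≡ not a
    xor-true false = refl
    xor-true true  = refl
  ring₁ : ∀ p z i i₀ D → p * z + i₀ + (1 + i₀ + i) * D + (1 + i) ≡ p * z + (1 + i₀ + i) * (1 + D)
  ring₁ = solve-∀
  ring₂ : ∀ p z j → p * z + j * (2 * p) ≡ p * (z + 2 * j)
  ring₂ = solve-∀
  ring₃ : ∀ p z y → p * (z + (1 + y)) ≡ p * (z + y) + p
  ring₃ = solve-∀
  arith : ∀ i → suc i₀ + i ≡ j → H * z + i₀ + j * D ≡ H * z′ + c
  -- Adding 1 + i to both sides removes the truncated subtraction in `c`.
  arith i refl = +-cancelʳ-≡ (suc i) _ _ (begin
    H * z + i₀ + j * D + suc i    ≡⟨ ring₁ H z i i₀ D ⟩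
    H * z + j * suc D             ≡⟨ cong (λ y → H * z + j * y) D≡ ⟩
    H * z + j * (2 * H)           ≡⟨ ring₂ H z j ⟩
    H * (z + 2 * j)               ≡⟨ cong (λ y → H * (z + y)) (sym 2j≡) ⟩
    H * (z + suc (2 * j ∸ 1))     ≡⟨ ring₃ H z (2 * j ∸ 1) ⟩
    H * z′ + H                    ≡⟨ cong (H * z′ +_) (sym (trans (cong (λ y → c + suc y) (sym (m+n∸m≡n (suc i₀) i))) (m∸n+n≡m i<H))) ⟩
    H * z′ + (c + suc i)          ≡⟨ +-assoc (H * z′) c (suc i) ⟨
    H * z′ + c + suc i            ∎)

-- The terms up to J read R at most 2 J places beyond the quotient; J ≤ 16 keeps this within the
-- block length 32 of the check.
crossing-change : ∀ c K i₀ J → J ≤ 16 → i₀ < 2 ^ K → J ∸ suc i₀ < 2 ^ K →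
  neverHolds 5 (λ o ω → const J (crossing c K i₀ o ω)) ≡ true →
  ∀ x z D → odd (K + suc x) ≡ c → suc D ≡ 2 * 2 ^ (K + suc x) →
  const J (λ j → R (2 ^ (K + suc x) * z + i₀ + j * D)) ≡ false
crossing-change c K i₀ J J≤ i₀< J< check x z D refl D≡ = trans
  (const-cong J λ j j≤J → crossing-correct K x i₀ z D j D≡ i₀< (≤-<-trans (∸-monoˡ-≤ (suc i₀) j≤J) J<))
  (refute 4 (2 * J) (*-monoʳ-≤ 2 J≤) (λ o ω → const J (crossing c K i₀ o ω))
    (λ o eq → const-cong J λ j j≤J → crossing-cong c K i₀ o j λ s s≤ → eq s (≤-trans s≤ (*-monoʳ-≤ 2 j≤J)))
    check z)

-- For odd k, so h is even: the residues 2, 1, 0, H - 1, H - 2. Two digits suffice for 2 and for the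
-- complements 0 and 1 of the last two.
odd-change : ∀ x z D → odd (2 + suc x) ≡ false → suc D ≡ 2 * 2 ^ (2 + suc x) →
  const 4 (λ j → R (2 ^ (2 + suc x) * z + 2 + j * D)) ≡ false
odd-change = crossing-change false 2 2 4 (≤ᵇ⇒≤ 4 16 _) (≤ᵇ⇒≤ 3 4 _) (≤ᵇ⇒≤ 2 4 _) refl

-- For even k: the residues 12, ..., 0, H - 1, H - 2. Stopping two steps after the crossing is what
-- keeps the total at H + 1 in `even-upper`.
even-change-12 : ∀ x z D → odd (4 + suc x) ≡ true → suc D ≡ 2 * 2 ^ (4 + suc x) →
  const 14 (λ j → R (2 ^ (4 + suc x) * z + 12 + j * D)) ≡ false
even-change-12 = crossing-change true 4 12 14 (≤ᵇ⇒≤ 14 16 _) (≤ᵇ⇒≤ 13 16 _) (≤ᵇ⇒≤ 2 16 _) refl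

-- Serves starting points with residue below 12: the residues 0, H - 1, ..., H - 13.
even-change-0 : ∀ x z D → odd (4 + suc x) ≡ true → suc D ≡ 2 * 2 ^ (4 + suc x) →
  const 13 (λ j → R (2 ^ (4 + suc x) * z + 0 + j * D)) ≡ false
even-change-0 = crossing-change true 4 0 13 (≤ᵇ⇒≤ 13 16 _) (≤ᵇ⇒≤ 1 16 _) (≤ᵇ⇒≤ 13 16 _) refl

-- For small d all terms up to the v-th lie in the range that one check covers, and no crossing is
-- involved.
short-change : ∀ K d v → v * d ≤ 2 ^ suc K →
  neverHolds (suc K) (λ o ω → const v (λ j → ω (j * d))) ≡ true →
  ∀ n → const v (λ j → R (n + j * d)) ≡ false
short-change K d v vd≤ = refute K (v * d) vd≤ (λ o ω → const v (λ j → ω (j * d)))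
  (λ o eq → const-cong v λ j j≤v → eq (j * d) (*-monoˡ-≤ d j≤v))

-- From changes of `R` to first changes of `r`, and the upper bounds for k ≥ 5.

R-along : ∀ n d → R (n + 0 * d) ≡ R n
R-along n d = cong R (+-identityʳ n)

bounded-by : ∀ d v → (∀ n → const v (λ j → R (n + j * d)) ≡ false) → ∀ n → Σ ℕ λ l → IsA n d l × l ≤ v
bounded-by d v change n with first-change v (λ j → R (n + j * d)) (change n)
... | l , (1≤l , differs , before) , l≤v = l , (1≤l , (λ eq → differs (trans (r≡⇒R≡ {n + l * d} {n} eq) (sym (R-along n d)))) ,
  λ j 1≤j j<l → R≡⇒r≡ {n + j * d} {n} (trans (before j 1≤j j<l) (R-along n d))) , l≤v

isA-intro : ∀ {n d l b} → 1 ≤ l → (∀ j → j < l → R (n + j * d) ≡ b) → R (n + l * d) ≡ not b → IsA n d l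
isA-intro {n} {d} {l} {b} 1≤l before at =
  1≤l , (λ eq → not-¬ (trans (r≡⇒R≡ {n + l * d} {n} eq) Rn) at) , λ j _ j<l → R≡⇒r≡ {n + j * d} {n} (trans (before j j<l) (sym Rn))
  where
  Rn : R n ≡ b
  Rn = trans (sym (R-along n d)) (before 0 1≤l)

change-from : ∀ {n d e L} j J → n + j * d ≡ e → j + J ≤ L →
  const J (λ i → R (e + i * d)) ≡ false → const L (λ i → R (n + i * d)) ≡ false
change-from {n} {d} j J refl j+J≤L change = const-shift j (λ i → R (n + i * d)) j+J≤L
  (trans (const-cong J λ i _ → cong R (lem n j i d)) change)
  where
  lem : ∀ n j i d → n + (j + i) * d ≡ n + j * d + i * d
  lem = solve-∀

-- From residue p it takes p steps to reach 0 and H - 2 = 1 + q more to come down from H - 1 to 2.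
-- The crossing costs 1 in the quotient.
descend-past : ∀ {H D} z p q → 3 + q ≡ H → suc D ≡ 2 * H →
  H * z + p + (p + suc q) * D ≡ H * (z + (2 * (p + q) + 1)) + 2
descend-past {H} {D} z p q refl D≡ = +-cancelʳ-≡ (suc q) _ _ (begin
  H * z + p + (p + suc q) * D + suc q          ≡⟨ ring₁ (H * z) p q D ⟩
  H * z + (p + suc q) * suc D                  ≡⟨ cong (λ y → H * z + (p + suc q) * y) D≡ ⟩
  H * z + (p + suc q) * (2 * H)                ≡⟨ ring₂ z p q ⟩
  H * (z + (2 * (p + q) + 1)) + 2 + suc q      ∎)
  where
  open ≡-Reasoning
  ring₁ : ∀ y p q D → y + p + (p + (1 + q)) * D + (1 + q) ≡ y + (p + (1 + q)) * (1 + D)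
  ring₁ = solve-∀
  ring₂ : ∀ z p q → (3 + q) * z + (p + (1 + q)) * (2 * (3 + q)) ≡ (3 + q) * (z + (2 * (p + q) + 1)) + 2 + (1 + q)
  ring₂ = solve-∀

odd-upper : ∀ x D → odd (2 + suc x) ≡ false → suc D ≡ 2 * 2 ^ (2 + suc x) →
  ∀ n → const (2 ^ (2 + suc x) + 3) (λ j → R (n + j * D)) ≡ false
odd-upper x D even-h D≡ n with 2^-split (2 + suc x) n
... | z , p , p<H , refl with 2 ≤? p
... | yes 2≤p = change-from j 4
        (trans (cong (λ y → H * z + y + j * D) (sym (m∸n+n≡m 2≤p))) (descend H z j 2 D≡))
        (begin j + 4        ≡⟨ +-assoc j 2 2 ⟨
               j + 2 + 2    ≡⟨ cong (_+ 2) (m∸n+n≡m 2≤p) ⟩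
               p + 2        ≤⟨ +-mono-≤ (<⇒≤ p<H) (n≤1+n 2) ⟩
               H + 3        ∎)
        (odd-change x (z + 2 * j) D even-h D≡)
  where
  open ≤-Reasoning
  H = 2 ^ (2 + suc x)
  j = p ∸ 2
-- Residue 2 is already passed, so the next crossing is used. Residue p = 1 is the worst case: 1 +
-- (H - 2) + 4 = H + 3.
... | no 2≰p = change-from (p + suc q) 4 (descend-past z p q q≡ D≡)
        (begin p + suc q + 4    ≤⟨ +-monoˡ-≤ 4 (+-monoˡ-≤ (suc q) (≤-pred (≰⇒> 2≰p))) ⟩
               suc (suc q) + 4  ≡⟨ cong (2 +_) (+-suc q 3) ⟩
               3 + q + 3        ≡⟨ cong (_+ 3) q≡ ⟩
               H + 3            ∎)
        (odd-change x (z + (2 * (p + q) + 1)) D even-h D≡)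
  where
  open ≤-Reasoning
  H = 2 ^ (2 + suc x)
  q = H ∸ 3
  q≡ : 3 + q ≡ H
  q≡ = m+[n∸m]≡n (≤-trans (≤ᵇ⇒≤ 3 8 _) (^-monoʳ-≤ 2 (m≤m+n 3 x)))

even-upper : ∀ x D → odd (4 + suc x) ≡ true → suc D ≡ 2 * 2 ^ (4 + suc x) →
  ∀ n → const (2 ^ (4 + suc x) + 1) (λ j → R (n + j * D)) ≡ false
even-upper x D odd-h D≡ n with 2^-split (4 + suc x) n
... | z , p , p<H , refl with 12 ≤? p
... | yes 12≤p = change-from j 14
        (trans (cong (λ y → H * z + y + j * D) (sym (m∸n+n≡m 12≤p))) (descend H z j 12 D≡))
        (begin j + 14       ≡⟨ +-assoc j 12 2 ⟨
               j + 12 + 2   ≡⟨ cong (_+ 2) (m∸n+n≡m 12≤p) ⟩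
               p + 2        ≡⟨ +-suc p 1 ⟩
               suc p + 1    ≤⟨ +-monoˡ-≤ 1 p<H ⟩
               H + 1        ∎)
        (even-change-12 x (z + 2 * j) D odd-h D≡)
  where
  open ≤-Reasoning
  H = 2 ^ (4 + suc x)
  j = p ∸ 12
-- The crossing is at most 11 steps away, and 11 + 13 = 24 is below 32 ≤ H.
... | no 12≰p = change-from p 13
        (trans (cong (λ y → H * z + y + p * D) (sym (+-identityʳ p))) (descend H z p 0 D≡))
        (begin p + 13   ≤⟨ +-monoˡ-≤ 13 (≤-pred (≰⇒> 12≰p)) ⟩
               24       ≤⟨ ≤ᵇ⇒≤ 24 32 _ ⟩
               32       ≤⟨ ^-monoʳ-≤ 2 (m≤m+n 5 x) ⟩
               H        ≤⟨ m≤m+n H 1 ⟩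
               H + 1    ∎)
        (even-change-0 x (z + 2 * p) D odd-h D≡)
  where
  open ≤-Reasoning
  H = 2 ^ (4 + suc x)

-- Progressions that attain the bounds.

module Witness (h D : ℕ) (D≡ : suc D ≡ 2 * 2 ^ suc h) where

  private
    k = suc (suc h)
    H = 2 ^ suc h

  start : ℕ
  start = 2 ^ k * 2 ^ k + D

  -- The term is 2 ^ k * (2 ^ k + m) + (D - m): a digit 1, the k digits of m, then their
  -- complements. Turning the complement back into m gives two copies of m that differ only in the
  -- digit put on top, `not (odd m)` or `true`.
  R-start : ∀ m → m ≤ D →
    R (start + m * D) ≡ (pairs k (not (odd m)) m xor pairs k true m) xor not (odd k)
  R-start m m≤D = begin
    R (start + m * D)                             ≡⟨ cong R (trans (cong (λ y → 2 ^ k * 2 ^ k + y + m * D) (sym m+c≡D)) (ring₁ (2 ^ k * 2 ^ k) m c D)) ⟩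
    R (2 ^ k * 2 ^ k + m * suc D + c)             ≡⟨ cong (λ y → R (2 ^ k * 2 ^ k + m * y + c)) D≡ ⟩
    R (2 ^ k * 2 ^ k + m * 2 ^ k + c)             ≡⟨ cong R (ring₂ (2 ^ k) m c) ⟩
    R (2 ^ k * w + c)                             ≡⟨ R-block k w c< ⟩
    pairs k (odd w) c xor R w                     ≡⟨ cong₂ (λ o b → pairs k o c xor b) odd-w R-w ⟩
    pairs k (odd m) c xor (pairs k true m xor false)
      ≡⟨ cong (_xor (pairs k true m xor false)) (trans (proj₂ (pairs-complement k (odd m) {c} {m} c+m)) (cong
           (λ b → pairs k (not (odd m)) m xor (odd k xor (odd m xor b))) (proj₁ (pairs-complement k (odd m) {c} {m} c+m)))) ⟩
    (pairs k (not (odd m)) m xor (odd k xor (odd m xor not (odd m)))) xor (pairs k true m xor false)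
      ≡⟨ lem (pairs k (not (odd m)) m) (odd k) (odd m) (pairs k true m) ⟩
    (pairs k (not (odd m)) m xor pairs k true m) xor not (odd k) ∎
    where
    open ≡-Reasoning
    c = D ∸ m
    w = 2 ^ k * 1 + m
    m+c≡D : m + c ≡ D
    m+c≡D = m+[n∸m]≡n m≤D
    m< : m < 2 ^ k
    m< = subst (m <_) D≡ (s≤s m≤D)
    c< : c < 2 ^ k
    c< = subst (c <_) D≡ (s≤s (m∸n≤m D m))
    c+m : suc (c + m) ≡ 2 ^ k
    c+m = trans (cong suc (trans (+-comm c m) m+c≡D)) D≡
    odd-w : odd w ≡ odd m
    odd-w = odd-block k 1 m<
    R-w : R w ≡ pairs k true m xor false
    R-w = R-block k 1 m<
    ring₁ : ∀ y m c D → y + (m + c) + m * D ≡ y + m * (1 + D) + c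
    ring₁ = solve-∀
    ring₂ : ∀ p m c → p * p + m * p + c ≡ p * (p * 1 + m) + c
    ring₂ = solve-∀
    lem : ∀ a k o b → (a xor (k xor (o xor not o))) xor (b xor false) ≡ (a xor b) xor not k
    lem = solve 4 (λ a k o b → (a :+ (k :+ (o :+ (con true :+ o)))) :+ (b :+ con false) := (a :+ b) :+ (con true :+ k)) refl
      where open xor-∧-Solver

  H<D : H < D
  H<D = ≤-pred (subst (2 + H ≤_) (sym (trans D≡ (cong (H +_) (+-identityʳ H))))
          (+-monoˡ-≤ H (^-monoʳ-≤ 2 {1} {suc h} (s≤s z≤n))))

  xor-self : ∀ a b → (a xor a) xor b ≡ b
  xor-self false b = refl
  xor-self true  b = refl

  -- The two copies of m cancel: for m < H the top digit of m is 0 and forms no block 11 with the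
  -- digit above it, and m = H is even, so both copies have a 1 above.
  R-start-const : ∀ m → m ≤ H → R (start + m * D) ≡ not (odd k)
  R-start-const m m≤H = trans (R-start m (≤-trans m≤H (<⇒≤ H<D)))
    (trans (cong (λ b → (b xor pairs k true m) xor not (odd k)) (lem (m≤n⇒m<n∨m≡n m≤H)))
           (xor-self (pairs k true m) (not (odd k))))
    where
    indep : m < H → ∀ o → pairs k o m ≡ pairs (suc h) false m xor false
    indep m<H o = trans (cong (λ y → pairs k o (y + m)) (sym (*-zeroʳ H))) (pairs-top (suc h) o false m<H)
    lem : m < H ⊎ m ≡ H → pairs k (not (odd m)) m ≡ pairs k true m
    lem (inj₁ m<H)  = trans (indep m<H _) (sym (indep m<H true))
    lem (inj₂ refl) = cong (λ o → pairs k (not o) H) (odd-2* (2 ^ h))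

  -- H + 1 is odd and has top digit 1, so exactly one of the two copies gains a block 11 at its top.
  R-start-change : R (start + suc H * D) ≡ not (not (odd k))
  R-start-change = trans (R-start (suc H) H<D) (trans (cong (λ o → (pairs k (not o) (suc H) xor pairs k true (suc H)) xor not (odd k)) odd-H)
      (trans (cong₂ (λ a b → (a xor b) xor not (odd k)) (top false) (top true)) (lem (pairs (suc h) true 1) (odd k))))
    where
    odd-H : odd (suc H) ≡ true
    odd-H = trans (odd-suc H) (cong not (odd-2* (2 ^ h)))
    top : ∀ o → pairs k o (suc H) ≡ pairs (suc h) true 1 xor o
    top o = trans (cong (pairs k o) (trans (+-comm 1 H) (cong (_+ 1) (sym (*-identityʳ H)))))
      (pairs-top (suc h) o true (^-monoʳ-≤ 2 {1} {suc h} (s≤s z≤n)))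
    lem : ∀ a b → ((a xor false) xor (a xor true)) xor not b ≡ not (not b)
    lem false b = refl
    lem true  b = refl

  even-lower : ∃ λ n → IsA n D (H + 1)
  even-lower = start , subst (IsA start D) (+-comm 1 H)
    (isA-intro {start} {D} (s≤s z≤n) (λ j j<1+H → R-start-const j (≤-pred j<1+H)) R-start-change)

  -- This is `start` moved back by two steps; the term in between is 4 ^ k.
  start₂ : ℕ
  start₂ = 2 ^ k * D + 1

  start₂+D : start₂ + 1 * D ≡ 2 ^ k * 2 ^ k
  start₂+D = trans (lem (2 ^ k * D) D) (trans (cong (2 ^ k * D +_) D≡) (trans (+-comm _ (2 ^ k)) (trans (sym (*-suc (2 ^ k) D)) (cong (2 ^ k *_) D≡))))
    where
    lem : ∀ y D → y + 1 + 1 * D ≡ y + (1 + D)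
    lem = solve-∀

  start₂+2D : ∀ j → start₂ + (2 + j) * D ≡ start + j * D
  start₂+2D j = trans (lem start₂ j D) (cong (λ y → y + D + j * D) start₂+D)
    where
    lem : ∀ y j D → y + (2 + j) * D ≡ y + 1 * D + D + j * D
    lem = solve-∀

  -- The digits are k ones, k - 1 zeros and a final 1, which makes k - 1 blocks 11. The ones are
  -- handled as the complement of the zero word.
  R-start₂ : odd k ≡ true → R start₂ ≡ false
  R-start₂ odd-k = begin
    R (2 ^ k * D + 1)                   ≡⟨ cong R (trans (+-comm _ 1) (cong suc (*-assoc 2 H D))) ⟩
    R (⟦ true ⟧ + 2 * (H * D))          ≡⟨ R-cons true (H * D) ⟩
    odd (H * D) xor R (H * D)           ≡⟨ cong₂ _xor_ (odd-2^ h D) (R-2^ (suc h) D) ⟩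
    R D                                 ≡⟨ cong (λ y → R (y + D)) (*-zeroʳ (2 ^ k)) ⟨
    R (2 ^ k * 0 + D)                   ≡⟨ R-block k 0 (subst (D <_) D≡ ≤-refl) ⟩
    pairs k false D xor false           ≡⟨ cong (_xor false) (proj₂ (pairs-complement k false {D} {0} D+0)) ⟩
    (pairs k true 0 xor (odd k xor lowest k false D)) xor false
      ≡⟨ cong₂ (λ a b → (a xor (b xor lowest k false D)) xor false) (pairs-zero k true) odd-k ⟩
    not (lowest k false D) xor false    ≡⟨ cong (λ a → not a xor false) (proj₁ (pairs-complement k false {D} {0} D+0)) ⟩
    false                               ∎
    where
    open ≡-Reasoning
    D+0 : suc (D + 0) ≡ 2 ^ k
    D+0 = trans (cong suc (+-identityʳ D)) D≡

  odd-lower : odd k ≡ true → ∃ λ n → IsA n D (H + 3)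
  odd-lower odd-k = start₂ , subst (IsA start₂ D) (+-comm 3 H) (isA-intro {start₂} {D} (s≤s z≤n) before
    (trans (cong R (start₂+2D (suc H))) (trans R-start-change (cong (λ b → not (not b)) odd-k))))
    where
    before : ∀ j → j < 3 + H → R (start₂ + j * D) ≡ false
    before 0 _ = trans (R-along start₂ D) (R-start₂ odd-k)
    before 1 _ = trans (cong R start₂+D) (trans (R-2^ k (2 ^ k)) (trans (cong R (sym (*-identityʳ (2 ^ k)))) (R-2^ k 1)))
    before (suc (suc j)) (s≤s (s≤s j<)) = trans (cong R (start₂+2D j)) (trans (R-start-const j (≤-pred j<)) (cong not odd-k))

-- The values for all k.

value-large : ∀ y → value (5 + y) ≡ 2 ^ (4 + y) + (1 + 2 * ⟦ not (odd y) ⟧)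
value-large y = cong (λ b → 2 ^ (4 + y) + (1 + 2 * b)) (trans (%2≡⟦odd⟧ (5 + y)) (cong ⟦_⟧ (odd-+ 5 y)))

large : ∀ y → IsSupA (2 ^ (5 + y) ∸ 1) (value (5 + y))
large y = subst (IsSupA (2 ^ (5 + y) ∸ 1)) (sym (value-large y)) (lem y (odd y) refl)
  where
  pred≡ : ∀ K → suc (2 ^ K ∸ 1) ≡ 2 ^ K
  pred≡ K = m+[n∸m]≡n {1} (m^n>0 2 K)
  lem : ∀ y b → odd y ≡ b → IsSupA (2 ^ (5 + y) ∸ 1) (2 ^ (4 + y) + (1 + 2 * ⟦ not b ⟧))
  lem y       false even-y = bounded-by _ _ (odd-upper (suc y) _ (trans (odd-+ 4 y) even-y) (pred≡ (5 + y))) ,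
    Witness.odd-lower (3 + y) _ (pred≡ (5 + y)) (trans (odd-+ 5 y) (cong not even-y))
  -- An odd y is positive, so h = 4 + y is at least 5, as `even-upper` demands.
  lem (suc x) true odd-y = bounded-by _ _ (even-upper x _ (trans (odd-+ 4 (suc x)) odd-y) (pred≡ (6 + x))) ,
    Witness.even-lower (4 + x) _ (pred≡ (6 + x))

short-lower : ∀ n d l {b} → const l (λ j → R (n + j * d)) ≡ true → R n ≡ b → R (n + suc l * d) ≡ not b → IsA n d (suc l)
short-lower n d l c Rn at = isA-intro {n} {d} (s≤s z≤n)
  (λ j j<1+l → trans (const-elim l _ c j (≤-pred j<1+l)) (trans (R-along n d) Rn)) at

theorem1p6 : (k : ℕ) → 1 ≤ k → IsSupA (2 ^ k ∸ 1) (value k)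
-- For k ≤ 4 the products v * d are 4, 15, 63 and 150, which fit into blocks of length 4, 16, 64 and
-- 256; the witnesses 7, 28, 95 and 39 are verified by evaluation.
theorem1p6 1 _ = bounded-by 1 4 (short-change 1 1 4 (≤ᵇ⇒≤ 4 4 _) refl) , 7 , short-lower 7 1 3 refl refl refl
theorem1p6 2 _ = bounded-by 3 5 (short-change 3 3 5 (≤ᵇ⇒≤ 15 16 _) refl) , 28 , short-lower 28 3 4 refl refl refl
theorem1p6 3 _ = bounded-by 7 9 (short-change 5 7 9 (≤ᵇ⇒≤ 63 64 _) refl) , 95 , short-lower 95 7 8 refl refl refl
theorem1p6 4 _ = bounded-by 15 10 (short-change 7 15 10 (≤ᵇ⇒≤ 150 256 _) refl) , 39 , short-lower 39 15 9 refl refl refl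
theorem1p6 (suc (suc (suc (suc (suc y))))) _ = large y
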